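{- Work in ZF (without the axiom of choice). Let $X$ be a set, let $k<\omega$, and let $A$ be an antichain in $\mathrm{Fin}(X,2)$ all of whose elements have domain of size exactly $k$. Then $A$ is finite, and $|A|\le 2^k$.
   Context: $\mathrm{Fin}(X,2)$ is the forcing poset of finite partial functions from $X$ to $2=\{0,1\}$, ordered by reverse inclusion ($q\le p$ iff $q\supseteq p$). Two conditions are compatible if they have a common extension (equivalently, their union is a function); an antichain is a set of pairwise incompatible conditions. -}

module Defs where

open import Data.Bool using (Bool)
open import Data.Nat using (ℕ; _≤_)
open import Data.Product using (_×_; _,_; proj₁)
open import Data.List using (List; map; length; _++_)
open import Data.List.Membership.Propositional using (_∈_)
open import Data.List.Relation.Unary.All using (All)
open import Data.List.Relation.Unary.AllPairs using (AllPairs)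
open import Data.List.Relation.Unary.Unique.Propositional using (Unique)
open import Relation.Binary.PropositionalEquality using (_≡_)
open import Relation.Nullary using (¬_)

-- A condition of Fin(X,2): a finite partial function X ⇀ 2, given by
-- its graph as a list of pairs whose first coordinates are pairwise distinct.
-- Its domain therefore has exactly  length graph  elements.
record Cond (X : Set) : Set where
  constructor cond
  field
    graph      : List (X × Bool)
    keysUnique : Unique (map proj₁ graph)

open Cond public

domSize : {X : Set} → Cond X → ℕ
domSize p = length (graph p)

-- two conditions are the same partial function (same graph as a set)
SameCond : {X : Set} → Cond X → Cond X → Set
SameCond p q = ∀ z → (z ∈ graph p → z ∈ graph q) × (z ∈ graph q → z ∈ graph p)

Compatible : {X : Set} → Cond X → Cond X → Set
Compatible p q = ∀ {x b b′} → (x , b) ∈ graph p ++ graph q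
                            → (x , b′) ∈ graph p ++ graph q → b ≡ b′

IsAntichain : {X : Set} → (Cond X → Set) → Set
IsAntichain A = ∀ p q → A p → A q → ¬ SameCond p q → ¬ Compatible p q

-- "A is finite with |A| ≤ n": every list of pairwise distinct members of A
-- has length at most n
AtMost : {X : Set} → ℕ → (Cond X → Set) → Set
AtMost n A = ∀ (L : List _) → All A L → AllPairs (λ p q → ¬ SameCond p q) L
             → length L ≤ n

-- Kraft's inequality for finite partial functions: over a finite domain D with
-- n elements, a condition q covers 2^(n ∸ |q|) of the 2^n total functions on D,
-- and incompatible conditions cover disjoint sets, so pairwise incompatible
-- conditions satisfy Σ 2^(n ∸ |q|) ≤ 2^n.  We prove this by induction on D,
-- splitting every condition along the two values at the first point of D.  When
-- all conditions have size k the sum is |A| · 2^(n ∸ k), giving |A| ≤ 2^k.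
-- Equality on X is undecidable, but the goal |A| ≤ 2^k is decidable, so we may
-- assume (by double negation) that equality is decided on the finitely many
-- points actually occurring in the conditions.
module Submission where

open import Defs
open import Data.Nat using (ℕ; _^_)
open import Relation.Binary.PropositionalEquality using (_≡_)

open import Algebra.Properties.CommutativeSemigroup using (interchange)
open import Data.Bool using (Bool; true; false)
open import Data.Bool.Properties using () renaming (_≟_ to _≟ᵇ_)
open import Data.Empty using (⊥-elim)
open import Data.List using (List; []; _∷_; map; concatMap; length; _++_)
open import Data.List.Membership.Propositional using (_∈_; _∉_)
open import Data.List.Membership.Propositional.Properties using (∈-++⁻; ∈-++⁺ˡ; ∈-++⁺ʳ; ∈-map⁺)
open import Data.List.Properties using (length-map; map-++)
open import Data.List.Relation.Binary.Subset.Propositional using (_⊆_)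
open import Data.List.Relation.Unary.All as All using (All; []; _∷_)
import Data.List.Relation.Unary.All.Properties as All
open import Data.List.Relation.Unary.AllPairs using (AllPairs; []; _∷_)
import Data.List.Relation.Unary.AllPairs.Properties as AllPairs
open import Data.List.Relation.Unary.Any using (here; there)
open import Data.List.Relation.Unary.Unique.Propositional using (Unique)
open import Data.Nat using (suc; _+_; _*_; _∸_; _≤_; _<_; z≤n; s≤s; _≤?_)
open import Data.Nat.ListAction using (sum)
open import Data.Nat.ListAction.Properties using (sum-++)
open import Data.Nat.Properties
open import Data.Product using (Σ-syntax; _×_; _,_; proj₁; proj₂)
open import Data.Sum using (_⊎_; inj₁; inj₂)
open import Function using (_∘_; id)
open import Relation.Binary.PropositionalEquality using (refl; sym; trans; cong; cong₂; subst)
open import Relation.Nullary using (¬_; Dec; yes; no)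
open import Relation.Nullary.Decidable using (decidable-stable)
open import Relation.Nullary.Decidable.Core using (¬¬-excluded-middle)

¬¬-all : ∀ {A : Set} {P : A → Set} → (∀ a → ¬ ¬ P a) → ∀ xs → ¬ ¬ All P xs
¬¬-all ¬¬P []       k = k []
¬¬-all ¬¬P (a ∷ xs) k = ¬¬P a λ pa → ¬¬-all ¬¬P xs λ pxs → k (pa ∷ pxs)

module _ {X : Set} where

  Graph : Set
  Graph = List (X × Bool)

  Functional : Graph → Set
  Functional g = ∀ {x b b′} → (x , b) ∈ g → (x , b′) ∈ g → b ≡ b′

  Incompatible : Graph → Graph → Set
  Incompatible g h = ¬ Functional (g ++ h)

  _∉dom_ : X → Graph → Set
  x ∉dom g = ∀ {b} → (x , b) ∉ g

  KeysIn : List X → Graph → Set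
  KeysIn D = All (λ e → proj₁ e ∈ D)

  DecidableOn : List X → Set
  DecidableOn D = ∀ {a b} → a ∈ D → b ∈ D → Dec (a ≡ b)

  functional-⊆ : ∀ {g h} → g ⊆ h → Functional h → Functional g
  functional-⊆ g⊆h fh m m′ = fh (g⊆h m) (g⊆h m′)

  functional-∷ : ∀ {x c g} → x ∉dom g → Functional g → Functional ((x , c) ∷ g)
  functional-∷ x∉g fg (here refl) (here refl) = refl
  functional-∷ x∉g fg (here refl) (there m)   = ⊥-elim (x∉g m)
  functional-∷ x∉g fg (there m)   (here refl) = ⊥-elim (x∉g m)
  functional-∷ x∉g fg (there m)   (there m′)  = fg m m′

  ∉dom-++ : ∀ {x} g {h} → x ∉dom g → x ∉dom h → x ∉dom (g ++ h)
  ∉dom-++ g x∉g x∉h m with ∈-++⁻ g m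
  ... | inj₁ m′ = x∉g m′
  ... | inj₂ m′ = x∉h m′

  unique⇒functional : ∀ g → Unique (map proj₁ g) → Functional g
  unique⇒functional (_ ∷ g) (u ∷ ug) (here refl) (here refl) = refl
  unique⇒functional (_ ∷ g) (u ∷ ug) (here refl) (there m)   = ⊥-elim (All.lookup u (∈-map⁺ proj₁ m) refl)
  unique⇒functional (_ ∷ g) (u ∷ ug) (there m)   (here refl) = ⊥-elim (All.lookup u (∈-map⁺ proj₁ m) refl)
  unique⇒functional (_ ∷ g) (u ∷ ug) (there m)   (there m′)  = unique⇒functional g ug m m′

  -- The number of total functions on an n-element domain extending q, provided
  -- the domain of q lies inside it.
  extensions : ℕ → Graph → ℕ
  extensions n q = 2 ^ (n ∸ length q)

  extensions-suc : ∀ n q → extensions (suc n) q ≤ 2 * extensions n q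
  extensions-suc n q = ^-monoʳ-≤ 2 (m≤n+o⇒m∸n≤o (suc n) (length q) (begin
    suc n                          ≤⟨ s≤s (m≤n+m∸n n (length q)) ⟩
    suc (length q + (n ∸ length q)) ≡⟨ sym (+-suc (length q) _) ⟩
    length q + suc (n ∸ length q)  ∎))
    where open ≤-Reasoning

  weight : ℕ → List Graph → ℕ
  weight n = sum ∘ map (extensions n)

  weight-++ : ∀ n L M → weight n (L ++ M) ≡ weight n L + weight n M
  weight-++ n L M = trans (cong sum (map-++ (extensions n) L M)) (sum-++ (map (extensions n) L) _)

  weight-uniform : ∀ n k L → All (λ q → length q ≡ k) L → weight n L ≡ length L * 2 ^ (n ∸ k)
  weight-uniform n k []      []            = refl
  weight-uniform n k (q ∷ L) (refl ∷ lenL) = cong (2 ^ (n ∸ k) +_) (weight-uniform n k L lenL)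

  module Split (x : X) where

    Decided : Graph → Set
    Decided = All (λ e → Dec (x ≡ proj₁ e))

    data Value (q : Graph) : Set where
      defined   : ∀ b → (x , b) ∈ q → Value q
      undefined : x ∉dom q → Value q

    value : ∀ q → Decided q → Value q
    value []      []             = undefined λ ()
    value (_ ∷ q) (yes refl ∷ _) = defined _ (here refl)
    value (_ ∷ q) (no x≢y ∷ ds) with value q ds
    ... | defined b m   = defined b (there m)
    ... | undefined x∉q = undefined λ { (here refl) → x≢y refl ; (there m) → x∉q m }

    delete : ∀ q → Decided q → Graph
    delete []      []           = []
    delete (_ ∷ q) (yes _ ∷ ds) = delete q ds
    delete (e ∷ q) (no _ ∷ ds)  = e ∷ delete q ds

    delete-⊆ : ∀ q ds → delete q ds ⊆ q
    delete-⊆ (_ ∷ q) (yes _ ∷ ds) m           = there (delete-⊆ q ds m)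
    delete-⊆ (_ ∷ q) (no _ ∷ ds)  (here refl) = here refl
    delete-⊆ (_ ∷ q) (no _ ∷ ds)  (there m)   = there (delete-⊆ q ds m)

    delete-∉dom : ∀ q ds → x ∉dom delete q ds
    delete-∉dom (_ ∷ q) (yes _ ∷ ds)  m           = delete-∉dom q ds m
    delete-∉dom (_ ∷ q) (no x≢y ∷ ds) (here refl) = x≢y refl
    delete-∉dom (_ ∷ q) (no _ ∷ ds)   (there m)   = delete-∉dom q ds m

    ∈-delete : ∀ q ds {y b} → (y , b) ∈ q → x ≡ y ⊎ (y , b) ∈ delete q ds
    ∈-delete (_ ∷ q) (yes x≡y ∷ ds) (here refl) = inj₁ x≡y
    ∈-delete (_ ∷ q) (yes _ ∷ ds)   (there m)   = ∈-delete q ds m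
    ∈-delete (_ ∷ q) (no _ ∷ ds)    (here refl) = inj₂ (here refl)
    ∈-delete (_ ∷ q) (no _ ∷ ds)    (there m)   with ∈-delete q ds m
    ... | inj₁ x≡y = inj₁ x≡y
    ... | inj₂ m′  = inj₂ (there m′)

    ⊆-∷-delete : ∀ {c} q ds → (x , c) ∈ q → Functional q → q ⊆ (x , c) ∷ delete q ds
    ⊆-∷-delete q ds xc∈q fq m with ∈-delete q ds m
    ... | inj₁ refl = subst (λ b → (x , b) ∈ _) (fq xc∈q m) (here refl)
    ... | inj₂ m′   = there m′

    length-delete-≤ : ∀ q ds → length (delete q ds) ≤ length q
    length-delete-≤ []      []           = z≤n
    length-delete-≤ (_ ∷ q) (yes _ ∷ ds) = m≤n⇒m≤1+n (length-delete-≤ q ds)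
    length-delete-≤ (_ ∷ q) (no _ ∷ ds)  = s≤s (length-delete-≤ q ds)

    length-delete-< : ∀ q ds {b} → (x , b) ∈ q → length (delete q ds) < length q
    length-delete-< (_ ∷ q) (yes _ ∷ ds)  _           = s≤s (length-delete-≤ q ds)
    length-delete-< (_ ∷ q) (no x≢y ∷ ds) (here refl) = ⊥-elim (x≢y refl)
    length-delete-< (_ ∷ q) (no _ ∷ ds)   (there m)   = s≤s (length-delete-< q ds m)

    -- q̃ is the condition q restricted to the half-space {x ↦ c}.
    Restricts : Bool → Graph → Graph → Set
    Restricts c q q̃ = q ⊆ (x , c) ∷ q̃ × q̃ ⊆ q × x ∉dom q̃

    restrictAt : Bool → ∀ q → Decided q → Value q → List Graph
    restrictAt c q ds (defined b _) with b ≟ᵇ c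
    ... | yes _ = delete q ds ∷ []
    ... | no _  = []
    restrictAt c q ds (undefined _) = q ∷ []

    restrict : Bool → ∀ q → Decided q → List Graph
    restrict c q ds = restrictAt c q ds (value q ds)

    restrictAll : Bool → ∀ L → All Decided L → List Graph
    restrictAll c []      []         = []
    restrictAll c (q ∷ L) (ds ∷ dss) = restrict c q ds ++ restrictAll c L dss

    restrictAt-restricts : ∀ c q ds v → Functional q
                         → ∀ {q̃} → q̃ ∈ restrictAt c q ds v → Restricts c q q̃
    restrictAt-restricts c q ds (defined b m) fq q̃∈ with b ≟ᵇ c | q̃∈
    ... | yes refl | here refl = ⊆-∷-delete q ds m fq , delete-⊆ q ds , delete-∉dom q ds
    restrictAt-restricts c q ds (undefined x∉q) fq (here refl) = there , id , x∉q

    restrictAt-pairwise : ∀ c q ds v → AllPairs Incompatible (restrictAt c q ds v)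
    restrictAt-pairwise c q ds (defined b _) with b ≟ᵇ c
    ... | yes _ = [] ∷ []
    ... | no _  = []
    restrictAt-pairwise c q ds (undefined _) = [] ∷ []

    ∈-restrictAll : ∀ c L dss → All Functional L → ∀ {q̃} → q̃ ∈ restrictAll c L dss
                  → Σ[ q ∈ Graph ] q ∈ L × Restricts c q q̃
    ∈-restrictAll c (q ∷ L) (ds ∷ dss) (fq ∷ fL) m with ∈-++⁻ (restrict c q ds) m
    ... | inj₁ m′ = q , here refl , restrictAt-restricts c q ds (value q ds) fq m′
    ... | inj₂ m′ with ∈-restrictAll c L dss fL m′
    ...   | r , r∈L , res = r , there r∈L , res

    -- Both restrictions fix x to the same value c, so they cannot disagree there.
    restricts-incompatible : ∀ {c q q̃ r r̃} → Restricts c q q̃ → Restricts c r r̃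
                           → Incompatible q r → Incompatible q̃ r̃
    restricts-incompatible {c} {q} {q̃} {r} {r̃} (q⊆ , _ , x∉q̃) (r⊆ , _ , x∉r̃) incompat fq̃r̃ =
      incompat (functional-⊆ qr⊆ (functional-∷ (∉dom-++ q̃ x∉q̃ x∉r̃) fq̃r̃))
      where
      qr⊆ : q ++ r ⊆ (x , c) ∷ q̃ ++ r̃
      qr⊆ m with ∈-++⁻ q m
      ... | inj₁ mq with q⊆ mq
      ...   | here eq = here eq
      ...   | there m′ = there (∈-++⁺ˡ m′)
      qr⊆ m | inj₂ mr with r⊆ mr
      ...   | here eq = here eq
      ...   | there m′ = there (∈-++⁺ʳ q̃ m′)

    restrictAll-pairwise : ∀ c L dss → All Functional L → AllPairs Incompatible L
                         → AllPairs Incompatible (restrictAll c L dss)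
    restrictAll-pairwise c []      []         _         _                 = []
    restrictAll-pairwise c (q ∷ L) (ds ∷ dss) (fq ∷ fL) (incompatQ ∷ incompatL) =
      AllPairs.++⁺ (restrictAt-pairwise c q ds (value q ds)) (restrictAll-pairwise c L dss fL incompatL)
        (All.tabulate λ q̃∈ → All.tabulate λ r̃∈ →
          cross (restrictAt-restricts c q ds (value q ds) fq q̃∈) (∈-restrictAll c L dss fL r̃∈))
      where
      cross : ∀ {q̃ r̃} → Restricts c q q̃ → Σ[ r ∈ Graph ] r ∈ L × Restricts c r r̃
            → Incompatible q̃ r̃
      cross resQ (r , r∈L , resR) = restricts-incompatible resQ resR (All.lookup incompatQ r∈L)

    restricts-keysIn : ∀ {c q q̃ D} → Restricts c q q̃ → KeysIn (x ∷ D) q → KeysIn D q̃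
    restricts-keysIn (_ , q̃⊆q , x∉q̃) keysQ = All.tabulate keyIn
      where
      keyIn : ∀ {e} → e ∈ _ → proj₁ e ∈ _
      keyIn e∈q̃ with All.lookup keysQ (q̃⊆q e∈q̃)
      ... | here refl = ⊥-elim (x∉q̃ e∈q̃)
      ... | there y∈D = y∈D

    extensions-delete : ∀ n q ds {b} → (x , b) ∈ q → extensions (suc n) q ≤ extensions n (delete q ds)
    extensions-delete n q ds m = ^-monoʳ-≤ 2 (∸-monoʳ-≤ (suc n) (length-delete-< q ds m))

    weight-restrictAt : ∀ n q ds v
                      → extensions (suc n) q ≤ weight n (restrictAt false q ds v) + weight n (restrictAt true q ds v)
    weight-restrictAt n q ds (defined false m)
      rewrite +-identityʳ (extensions n (delete q ds)) | +-identityʳ (extensions n (delete q ds))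
      = extensions-delete n q ds m
    weight-restrictAt n q ds (defined true m)
      rewrite +-identityʳ (extensions n (delete q ds)) = extensions-delete n q ds m
    weight-restrictAt n q ds (undefined _) =
      ≤-trans (extensions-suc n q)
        (≤-reflexive (cong (_+ (extensions n q + 0)) (sym (+-identityʳ (extensions n q)))))

    weight-restrictAll : ∀ n L dss
                       → weight (suc n) L ≤ weight n (restrictAll false L dss) + weight n (restrictAll true L dss)
    weight-restrictAll n []      []         = z≤n
    weight-restrictAll n (q ∷ L) (ds ∷ dss) = begin
      extensions (suc n) q + weight (suc n) L
        ≤⟨ +-mono-≤ (weight-restrictAt n q ds (value q ds)) (weight-restrictAll n L dss) ⟩
      (qF + qT) + (LF + LT)  ≡⟨ interchange +-commutativeSemigroup qF qT LF LT ⟩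
      (qF + LF) + (qT + LT)
        ≡⟨ sym (cong₂ _+_ (weight-++ n (restrict false q ds) _) (weight-++ n (restrict true q ds) _)) ⟩
      weight n (restrictAll false (q ∷ L) (ds ∷ dss)) + weight n (restrictAll true (q ∷ L) (ds ∷ dss)) ∎
      where
      open ≤-Reasoning
      qF qT LF LT : ℕ
      qF = weight n (restrict false q ds)
      qT = weight n (restrict true q ds)
      LF = weight n (restrictAll false L dss)
      LT = weight n (restrictAll true L dss)

  kraft : ∀ D → DecidableOn D → ∀ L → All Functional L → All (KeysIn D) L → AllPairs Incompatible L
        → weight (length D) L ≤ 2 ^ length D
  kraft []      _   []                 _ _                  _                    = z≤n
  kraft []      _   ([] ∷ [])          _ _                  _                    = ≤-refl
  kraft []      _   ([] ∷ [] ∷ _)      _ _                  ((incompat ∷ _) ∷ _) = ⊥-elim (incompat λ ())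
  kraft []      _   ((_ ∷ _) ∷ _)      _ ((() ∷ _) ∷ _)     _
  kraft []      _   ([] ∷ (_ ∷ _) ∷ _) _ (_ ∷ (() ∷ _) ∷ _) _
  kraft (x ∷ D) dec L fL keysL incompatL = begin
    weight (suc n) L                                                        ≤⟨ weight-restrictAll n L dss ⟩
    weight n (restrictAll false L dss) + weight n (restrictAll true L dss)  ≤⟨ +-mono-≤ (half false) (half true) ⟩
    2 ^ n + 2 ^ n                                                           ≡⟨ cong (2 ^ n +_) (sym (+-identityʳ _)) ⟩
    2 ^ suc n                                                               ∎
    where
    open Split x
    open ≤-Reasoning
    n : ℕ
    n = length D
    dss : All Decided L
    dss = All.map (All.map (dec (here refl))) keysL
    inherited : ∀ c {q̃} → q̃ ∈ restrictAll c L dss → Functional q̃ × KeysIn D q̃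
    inherited c q̃∈ with ∈-restrictAll c L dss fL q̃∈
    ... | q , q∈L , res@(_ , q̃⊆q , _) =
      functional-⊆ q̃⊆q (All.lookup fL q∈L) , restricts-keysIn res (All.lookup keysL q∈L)
    half : ∀ c → weight n (restrictAll c L dss) ≤ 2 ^ n
    half c = kraft D (λ a∈D b∈D → dec (there a∈D) (there b∈D)) (restrictAll c L dss)
               (All.tabulate (proj₁ ∘ inherited c)) (All.tabulate (proj₂ ∘ inherited c))
               (restrictAll-pairwise c L dss fL incompatL)

  length≤2^size : ∀ D → DecidableOn D → ∀ k L → All Functional L → All (KeysIn D) L
                → AllPairs Incompatible L → All (λ q → length q ≡ k) L → length L ≤ 2 ^ k
  length≤2^size D dec k L fL keysL incompatL sizeL =
    *-cancelʳ-≤ (length L) (2 ^ k) (2 ^ (n ∸ k)) {{m^n≢0 2 (n ∸ k)}} (begin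
      length L * 2 ^ (n ∸ k)  ≡⟨ sym (weight-uniform n k L sizeL) ⟩
      weight n L              ≤⟨ kraft D dec L fL keysL incompatL ⟩
      2 ^ n                   ≤⟨ ^-monoʳ-≤ 2 (m≤n+m∸n n k) ⟩
      2 ^ (k + (n ∸ k))       ≡⟨ ^-distribˡ-+-* 2 k (n ∸ k) ⟩
      2 ^ k * 2 ^ (n ∸ k)     ∎)
    where
    open ≤-Reasoning
    n : ℕ
    n = length D

  allKeys : List Graph → List X
  allKeys = concatMap (map proj₁)

  keysIn-allKeys : ∀ Ls → All (KeysIn (allKeys Ls)) Ls
  keysIn-allKeys []       = []
  keysIn-allKeys (g ∷ Ls) = All.tabulate (∈-++⁺ˡ ∘ ∈-map⁺ proj₁)
                          ∷ All.map (All.map (∈-++⁺ʳ (map proj₁ g))) (keysIn-allKeys Ls)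

  ¬¬-decidableOn : ∀ D → ¬ ¬ DecidableOn D
  ¬¬-decidableOn D k = ¬¬-all (λ a → ¬¬-all (λ _ → ¬¬-excluded-middle) D) D
    λ table → k λ a∈D b∈D → All.lookup (All.lookup table a∈D) b∈D

  antichain⇒incompatible : ∀ {A} → IsAntichain A → ∀ {L} → All A L
                         → AllPairs (λ p q → ¬ SameCond p q) L
                         → AllPairs (λ p q → Incompatible (graph p) (graph q)) L
  antichain⇒incompatible anti []        []                     = []
  antichain⇒incompatible anti (ap ∷ AL) (distinct ∷ distinctL) =
    All.zipWith (λ {q} (aq , p≉q) → anti _ q ap aq p≉q) (AL , distinct)
    ∷ antichain⇒incompatible anti AL distinctL

lemma1p3 : {X : Set} (k : ℕ) (A : Cond X → Set)
         → IsAntichain A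
         → (∀ p → A p → domSize p ≡ k)
         → AtMost (2 ^ k) A
lemma1p3 {X} k A anti size L AL distinct =
  decidable-stable (length L ≤? 2 ^ k) λ ≰ → ¬¬-decidableOn keys (≰ ∘ bound)
  where
  graphs : List (List (X × Bool))
  graphs = map graph L
  keys : List X
  keys = allKeys graphs
  bound : DecidableOn keys → length L ≤ 2 ^ k
  bound dec = subst (_≤ 2 ^ k) (length-map graph L)
    (length≤2^size keys dec k graphs
      (All.map⁺ (All.tabulate λ {p} _ → unique⇒functional (graph p) (keysUnique p)))
      (keysIn-allKeys graphs)
      (AllPairs.map⁺ (antichain⇒incompatible anti AL distinct))
      (All.map⁺ (All.map (λ {p} → size p) AL)))
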